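{- For all formulas $\phi,\psi,\chi$ of the team language, the formula $(\phi\to\chi)\to(\phi\vee\psi\to\chi\vee\psi)$ is valid on every distributive general intuitionistic team Kripke frame.
   Context: **Language.** Fix a set $\mathsf{Prop}$ of propositional variables. Formulas of the team language are $\phi::=p\mid\bot\mid\phi\wedge\phi\mid\phi\vee\phi\mid\phi\veebar\phi\mid\phi\to\phi$; $\vee$ is the local and $\veebar$ the global disjunction; $\vee$ and $\veebar$ bind more strongly than $\to$. **Frames.** For a nonempty set $W$ with a partial order $R$, teams are sets $t\subseteq W$; $R[t]=\{v\mid\exists w\in t:\ wRv\}$; and $tR^\circ s$ iff $\forall w\in t\,\exists v\in s\,(wRv)$ and $\forall v\in s\,\exists w\in t\,(wRv)$. A general intuitionistic team Kripke frame is $(W,R,\succcurlyeq,\Cup)$ where $W\neq\varnothing$, $R$ is a partial order on $W$, $\Cup$ is a binary operation on $\wp(W)$ such that $(\wp(W),\Cup,\varnothing)$ is a bounded join-semilattice ($\Cup$ associative, commutative, idempotent, $\varnothing\Cup t=t$), $\preccurlyeq$ is the induced partial order ($t\preccurlyeq s$ iff $t\Cup s=s$) with converse $\succcurlyeq$, and for all $t,s,s'\subseteq W$: - (a) if $tR^\circ s$ and $s\succcurlyeq s'$, then there is $t'\subseteq W$ with $t\succcurlyeq t'$ and $t'R^\circ s'$; - (b) $t\succcurlyeq\circ R^\circ s$ implies $R[t]\succcurlyeq s$, where $t\succcurlyeq\circ R^\circ s$ means there is $r\subseteq W$ with $t\succcurlyeq r$ and $rR^\circ s$; - (c) $R[t]\Cup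 R[s]=R[t\Cup s]$. The frame is distributive if for all $t,r,s\subseteq W$, $t\preccurlyeq r\Cup s$ implies that there are $r',s'\subseteq W$ with $r'\preccurlyeq r$, $s'\preccurlyeq s$ and $t=r'\Cup s'$. A model on the frame adds a valuation $V:\mathsf{Prop}\to\wp(W)$ persistent w.r.t. $R$ ($w\in V(p)$, $wRv$ imply $v\in V(p)$). **Generalized team semantics:** - $\mathfrak{M},t\models p$ iff $t\preccurlyeq V(p)$; - $\mathfrak{M},t\models\bot$ iff $t=\varnothing$; - $\mathfrak{M},t\models\phi\wedge\psi$ iff $\mathfrak{M},t\models\phi$ and $\mathfrak{M},t\models\psi$; - $\mathfrak{M},t\models\phi\vee\psi$ iff there are $s,r\subseteq W$ with $t\preccurlyeq s\Cup r$, $\mathfrak{M},s\models\phi$ and $\mathfrak{M},r\models\psi$; - $\mathfrak{M},t\models\phi\veebar\psi$ iff $\mathfrak{M},t\models\phi$ or $\mathfrak{M},t\models\psi$; - $\mathfrak{M},t\models\phi\to\psi$ iff for all $s\subseteq W$ with $t\succcurlyeq\circ R^\circ s$, $\mathfrak{M},s\models\phi$ implies $\mathfrak{M},s\models\psi$. A formula is valid on a frame if it holds at all teams in all models on the frame. -}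

module Defs where

open import Level using (Level; suc; _⊔_; Lift)
open import Data.Product.Base using (_×_; ∃-syntax)
open import Data.Sum.Base using (_⊎_)
open import Algebra.Core using (Op₂)
open import Algebra.Lattice.Structures using (IsBoundedJoinSemilattice)
open import Relation.Binary.Core using (Rel)
open import Relation.Binary.Structures using (IsPartialOrder)
open import Relation.Binary.PropositionalEquality.Core using (_≡_)
open import Relation.Unary using (Pred; _∈_; _≐_)
open import Relation.Unary.Polymorphic using (∅)

infixr 7 _∧_
infixr 6 _∨_ _⩒_
infixr 5 _⇒_

-- _∨_ is the local and _⩒_ the global disjunction.
data Formula {v} (Var : Set v) : Set v where
  var         : Var → Formula Var
  ⊥           : Formula Var
  _∧_ _∨_ _⩒_ : (φ ψ : Formula Var) → Formula Var
  _⇒_         : (φ ψ : Formula Var) → Formula Var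

module _ {ℓ} {W : Set ℓ} (R : Rel W ℓ) where

  Image : Pred W ℓ → Pred W ℓ
  Image t v = ∃[ w ] (w ∈ t × R w v)

  Lifting : Rel (Pred W ℓ) ℓ
  Lifting t s = (∀ w → w ∈ t → ∃[ v ] (v ∈ s × R w v))
              × (∀ v → v ∈ s → ∃[ w ] (w ∈ t × R w v))

-- Equality of teams is mutual inclusion _≐_, so ℘(W) is a setoid; that _⋓_ is
-- a well-defined operation on it is the congruence contained in
-- IsBoundedJoinSemilattice.
record Frame ℓ : Set (suc ℓ) where
  infixl 6 _⋓_
  infix  4 _R°_ _≼_ _≽_ _≽∘R°_

  field
    W              : Set ℓ
    inhabited      : W
    R              : Rel W ℓ
    isPartialOrder : IsPartialOrder _≡_ R

  Team : Set (suc ℓ)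
  Team = Pred W ℓ

  R[_] : Team → Team
  R[_] = Image R

  _R°_ : Rel Team ℓ
  _R°_ = Lifting R

  field
    _⋓_                      : Op₂ Team
    isBoundedJoinSemilattice : IsBoundedJoinSemilattice _≐_ _⋓_ ∅

  _≼_ : Rel Team ℓ
  t ≼ s = t ⋓ s ≐ s

  _≽_ : Rel Team ℓ
  t ≽ s = s ≼ t

  _≽∘R°_ : Rel Team (suc ℓ)
  t ≽∘R° s = ∃[ r ] (t ≽ r × r R° s)

  field
    R°-≽-commute : ∀ t s s′ → t R° s → s ≽ s′ → ∃[ t′ ] (t ≽ t′ × t′ R° s′)
    ≽∘R°⇒R[]≽    : ∀ t s → t ≽∘R° s → R[ t ] ≽ s
    R[]-⋓        : ∀ t s → R[ t ] ⋓ R[ s ] ≐ R[ t ⋓ s ]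

Distributive : ∀ {ℓ} → Frame ℓ → Set (suc ℓ)
Distributive F = ∀ t r s → t ≼ r ⋓ s →
                 ∃[ r′ ] ∃[ s′ ] (r′ ≼ r × s′ ≼ s × t ≐ r′ ⋓ s′)
  where open Frame F

record Model {v ℓ} (Var : Set v) (F : Frame ℓ) : Set (v ⊔ suc ℓ) where
  open Frame F
  field
    V          : Var → Team
    persistent : ∀ p {w v} → w ∈ V p → R w v → v ∈ V p

module _ {v ℓ} {Var : Set v} {F : Frame ℓ} where
  open Frame F

  infix 3 _,_⊨_

  -- Quantifying over teams raises the level, whence the Lift at var and ⊥.
  _,_⊨_ : Model Var F → Team → Formula Var → Set (suc ℓ)
  M , t ⊨ var p = Lift (suc ℓ) (t ≼ Model.V M p)
  M , t ⊨ ⊥     = Lift (suc ℓ) (t ≐ ∅ {ℓ = ℓ})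
  M , t ⊨ φ ∧ ψ = (M , t ⊨ φ) × (M , t ⊨ ψ)
  M , t ⊨ φ ∨ ψ = ∃[ s ] ∃[ r ] (t ≼ s ⋓ r × (M , s ⊨ φ) × (M , r ⊨ ψ))
  M , t ⊨ φ ⩒ ψ = (M , t ⊨ φ) ⊎ (M , t ⊨ ψ)
  M , t ⊨ φ ⇒ ψ = ∀ s → t ≽∘R° s → M , s ⊨ φ → M , s ⊨ ψ

ValidOn : ∀ {v ℓ} {Var : Set v} → Frame ℓ → Formula Var → Set (v ⊔ suc ℓ)
ValidOn {Var = Var} F φ = (M : Model Var F) (t : Frame.Team F) → M , t ⊨ φ

-- Distributivity splits a team u ⊨ φ ∨ ψ exactly, u = a′ ⋓ b′ with a′ ⊨ φ and
-- b′ ⊨ ψ. Then a′ ≼ u, so the commutation condition R°-≽-commute makes a′ a team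
-- at which the hypothesis φ ⇒ χ applies.
module Submission where

open import Level using (lift)
open import Data.Product.Base using (_,_)
open import Data.Sum.Base using (map)
open import Algebra.Structures using (module IsIdempotentCommutativeMonoid)
open import Relation.Unary using (_≐_)

open import Defs

module _ {ℓ} (F : Frame ℓ) where
  open Frame F
  open IsIdempotentCommutativeMonoid isBoundedJoinSemilattice

  ≼-trans : ∀ {t s u} → t ≼ s → s ≼ u → t ≼ u
  ≼-trans {t} {s} {u} t≼s s≼u =
    trans (∙-congˡ (sym s≼u)) (trans (sym (assoc t s u)) (trans (∙-congʳ t≼s) s≼u))

  ≼-reflexive : ∀ {t s} → t ≐ s → t ≼ s
  ≼-reflexive {s = s} t≐s = trans (∙-congʳ t≐s) (idem s)

  t≼t⋓s : ∀ t s → t ≼ t ⋓ s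
  t≼t⋓s t s = trans (sym (assoc t t s)) (∙-congʳ (idem t))

  ≽-≽∘R°-trans : ∀ {t s u} → t ≽ s → s ≽∘R° u → t ≽∘R° u
  ≽-≽∘R°-trans t≽s (r , s≽r , rR°u) = r , ≼-trans s≽r t≽s , rR°u

  -- `R°-≽-commute` moves the final descent in front of the `R°` step, where it merges with the
  -- first descent.
  ≽∘R°-≽-trans : ∀ {t s u} → t ≽∘R° s → s ≽ u → t ≽∘R° u
  ≽∘R°-≽-trans (r , t≽r , rR°s) s≽u =
    let r′ , r≽r′ , r′R°u = R°-≽-commute _ _ _ rR°s s≽u
    in r′ , ≼-trans r≽r′ t≽r , r′R°u

  module _ {v} {Var : Set v} (M : Model Var F) where

    -- For `∨` only `≼` is demanded of the cover, so it can be reused; for `⇒` a smaller team has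
    -- fewer `≽∘R°`-successors.
    ⊨-downward : ∀ φ {t s} → s ≼ t → M , t ⊨ φ → M , s ⊨ φ
    ⊨-downward (var p) s≼t (lift t≼V) = lift (≼-trans s≼t t≼V)
    ⊨-downward ⊥ {s = s} s≼t (lift t≐∅) =
      -- `s ≼ ∅` unfolds to `s ⋓ ∅ ≐ ∅`, whose left side is `s`.
      lift (trans (sym (identityʳ s)) (≼-trans s≼t (≼-reflexive t≐∅)))
    ⊨-downward (φ ∧ ψ) s≼t (t⊨φ , t⊨ψ) = ⊨-downward φ s≼t t⊨φ , ⊨-downward ψ s≼t t⊨ψ
    ⊨-downward (φ ∨ ψ) s≼t (a , b , t≼a⋓b , a⊨φ , b⊨ψ) =
      a , b , ≼-trans s≼t t≼a⋓b , a⊨φ , b⊨ψ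
    ⊨-downward (φ ⩒ ψ) s≼t = map (⊨-downward φ s≼t) (⊨-downward ψ s≼t)
    ⊨-downward (φ ⇒ ψ) s≼t t⊨φ⇒ψ u s≽∘R°u = t⊨φ⇒ψ u (≽-≽∘R°-trans s≼t s≽∘R°u)

proposition4p26 : ∀ {v ℓ} (Var : Set v) (φ ψ χ : Formula Var) →
    (F : Frame ℓ) → Distributive F →
    ValidOn F ((φ ⇒ χ) ⇒ (φ ∨ ψ ⇒ χ ∨ ψ))
proposition4p26 Var φ ψ χ F distributive M _ s _ s⊨φ⇒χ u s≽∘R°u (a , b , u≼a⋓b , a⊨φ , b⊨ψ) =
  let open Frame F
      open IsIdempotentCommutativeMonoid isBoundedJoinSemilattice
      -- Since only `u ≼ a ⋓ b` is given, `a` itself may be out of reach of `s`, where `φ ⇒ χ` is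
      -- known; its part `a′` lies below `u`.
      a′ , b′ , a′≼a , b′≼b , u≐a′⋓b′ = distributive u a b u≼a⋓b
      a′≼u = ≼-trans F (t≼t⋓s F a′ b′) (≼-reflexive F (sym u≐a′⋓b′))
      a′⊨χ = s⊨φ⇒χ a′ (≽∘R°-≽-trans F s≽∘R°u a′≼u) (⊨-downward F M φ a′≼a a⊨φ)
  in a′ , b′ , ≼-reflexive F u≐a′⋓b′ , a′⊨χ , ⊨-downward F M ψ b′≼b b⊨ψ
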